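{- For every fixed integer $k\geq 1$ there exists a constant $c_k>0$ (depending only on $k$) such that for every $n\geq k$ and every non-trivial $k$-uniform hypergraph property $f:\{0,1\}^{\binom{n}{k}}\rightarrow\{0,1\}$ on $n$ vertices, $s(f)\geq c_k\, n$; that is, $s(f)=\Omega(n)$.
   Context: For a Boolean function $f:\{0,1\}^N\rightarrow\{0,1\}$ and an input $x\in\{0,1\}^N$, let $x^{\{i\}}$ denote $x$ with its $i$-th bit flipped. The sensitivity of $f$ on $x$ is $s(f,x)=|\{i : f(x)\neq f(x^{\{i\}})\}|$, and the sensitivity of $f$ is $s(f)=\max_x s(f,x)$. Index the variables of $f:\{0,1\}^{\binom{n}{k}}\rightarrow\{0,1\}$ by the $k$-element subsets $S$ of $[n]=\{1,\dots,n\}$ (so an input $x=(x_S)_S$ encodes a $k$-uniform hypergraph on vertex set $[n]$). The function $f$ is called a $k$-uniform hypergraph property if for every input $x=(x_S)_S$ and every permutation $\sigma\in S_n$, $f((x_S)_S)=f((x_{\sigma(S)})_S)$, where $\sigma(S)=\{\sigma(i) : i\in S\}$. Non-trivial means non-constant. -}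

module Defs where

open import Data.Bool.Base using (Bool; true; false; not; if_then_else_)
open import Data.Bool.Properties using () renaming (_≟_ to _≟ᵇ_)
open import Data.Fin.Base using (Fin; zero)
open import Data.Fin.Permutation using (Permutation′; _⟨$⟩ʳ_; _⟨$⟩ˡ_; inverseˡ; cast-id; flip)
open import Data.Fin.Properties using (+↔⊎)
open import Data.Fin.Subset using (Subset; ⊥; inside; outside; ∣_∣)
open import Data.Fin.Subset.Properties using (∣⊥∣≡0)
open import Data.List.Base using (List; []; _∷_; allFin; cartesianProductWith; filter; length; map)
open import Data.List.Extrema.Nat using (max)
open import Data.Nat.Base using (ℕ; zero; suc)
open import Data.Nat.Combinatorics using (_C_; nCk+nC[k+1]≡[n+1]C[k+1])
open import Data.Nat.Properties using (≡-irrelevant; suc-injective; +-0-commutativeMonoid)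
open import Data.Product.Base using (∃; _,_; proj₁; proj₂)
open import Data.Sum.Base using (_⊎_; inj₁; inj₂)
open import Data.Sum.Function.Propositional using (_⊎-↔_)
open import Data.Vec.Base using (Vec; []; _∷_; lookup; tabulate; _[_]%=_)
open import Data.Vec.Properties using (lookup∘tabulate; tabulate∘lookup)
open import Function.Base using (_∘_)
open import Function.Bundles using (_↔_; Inverse; mk↔ₛ′)
open import Function.Construct.Composition using (_↔-∘_)
open import Function.Construct.Symmetry using (↔-sym)
open import Relation.Binary.PropositionalEquality
open import Relation.Nullary.Decidable using (¬?)
open import Algebra.Properties.CommutativeMonoid.Sum +-0-commutativeMonoid using (sum; sum-permute)

private
  variable
    n k N : ℕ

Input : ℕ → Set
Input N = Vec Bool N

BoolFun : ℕ → Set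
BoolFun N = Input N → Bool

Constant : BoolFun N → Set
Constant f = ∃ λ b → ∀ x → f x ≡ b

flipBit : Input N → Fin N → Input N
flipBit x i = x [ i ]%= not

sensitivityAt : BoolFun N → Input N → ℕ
sensitivityAt {N} f x =
  length (filter (λ i → ¬? (f x ≟ᵇ f (flipBit x i))) (allFin N))

allInputs : ∀ N → List (Input N)
allInputs zero    = [] ∷ []
allInputs (suc N) = cartesianProductWith _∷_ (false ∷ true ∷ []) (allInputs N)

-- The base value 0 of max does not matter: the list is non-empty and its
-- entries are natural numbers.
sensitivity : BoolFun N → ℕ
sensitivity {N} f = max 0 (map (sensitivityAt f) (allInputs N))

KSubset : ℕ → ℕ → Set
KSubset n k = ∃ λ (S : Subset n) → ∣ S ∣ ≡ k

KSubset-≡ : {S T : KSubset n k} → proj₁ S ≡ proj₁ T → S ≡ T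
KSubset-≡ {S = S , p} {T = .S , q} refl = cong (S ,_) (≡-irrelevant p q)

∣p∣≡0⇒p≡⊥ : (p : Subset n) → ∣ p ∣ ≡ 0 → p ≡ ⊥
∣p∣≡0⇒p≡⊥ []            _  = refl
∣p∣≡0⇒p≡⊥ (outside ∷ p) eq = cong (outside ∷_) (∣p∣≡0⇒p≡⊥ p eq)

pascal : KSubset (suc n) (suc k) ↔ (KSubset n k ⊎ KSubset n (suc k))
pascal {n} {k} = mk↔ₛ′ to from to∘from from∘to
  where
  to : KSubset (suc n) (suc k) → KSubset n k ⊎ KSubset n (suc k)
  to (inside  ∷ S , p) = inj₁ (S , suc-injective p)
  to (outside ∷ S , p) = inj₂ (S , p)

  from : KSubset n k ⊎ KSubset n (suc k) → KSubset (suc n) (suc k)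
  from (inj₁ (S , p)) = inside  ∷ S , cong suc p
  from (inj₂ (S , p)) = outside ∷ S , p

  to∘from : ∀ y → to (from y) ≡ y
  to∘from (inj₁ _) = cong inj₁ (KSubset-≡ refl)
  to∘from (inj₂ _) = refl

  from∘to : ∀ S → from (to S) ≡ S
  from∘to (inside  ∷ _ , _) = KSubset-≡ refl
  from∘to (outside ∷ _ , _) = refl

-- A fixed numbering of the k-subsets, identifying the index set of the
-- variables x_S with Fin (n C k).
index↔ : ∀ n k → KSubset n k ↔ Fin (n C k)
index↔ n       zero    = mk↔ₛ′ (λ _ → zero) (λ _ → ⊥ , ∣⊥∣≡0 n)
  (λ { zero → refl }) (λ (S , p) → KSubset-≡ (sym (∣p∣≡0⇒p≡⊥ S p)))
index↔ zero    (suc k) = mk↔ₛ′ (λ { ([] , ()) }) (λ ()) (λ ()) (λ { ([] , ()) })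
index↔ (suc n) (suc k) =
  cast-id (nCk+nC[k+1]≡[n+1]C[k+1] n k) ↔-∘
  (↔-sym +↔⊎ ↔-∘ ((index↔ n k ⊎-↔ index↔ n (suc k)) ↔-∘ pascal))

index : KSubset n k → Fin (n C k)
index = Inverse.to (index↔ _ _)

subsetAt : Fin (n C k) → KSubset n k
subsetAt = Inverse.from (index↔ _ _)

-- σ(S) = {σ(i) : i ∈ S}, written through its membership test:
-- j ∈ σ(S) iff σ⁻¹(j) ∈ S.
image : Permutation′ n → Subset n → Subset n
image σ S = tabulate (λ j → lookup S (σ ⟨$⟩ˡ j))

lookup-image : (σ : Permutation′ n) (S : Subset n) (i : Fin n) →
               lookup (image σ S) (σ ⟨$⟩ʳ i) ≡ lookup S i
lookup-image σ S i =
  trans (lookup∘tabulate _ (σ ⟨$⟩ʳ i)) (cong (lookup S) (inverseˡ σ))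

∣tabulate∣≡sum : (g : Fin n → Bool) →
                 ∣ tabulate g ∣ ≡ sum (λ i → if g i then 1 else 0)
∣tabulate∣≡sum {zero}  g = refl
∣tabulate∣≡sum {suc n} g with g zero
... | true  = cong suc (∣tabulate∣≡sum (g ∘ Fin.suc))
... | false = ∣tabulate∣≡sum (g ∘ Fin.suc)

∣image∣ : (σ : Permutation′ n) (S : Subset n) → ∣ image σ S ∣ ≡ ∣ S ∣
∣image∣ σ S = begin
  ∣ image σ S ∣                ≡⟨ ∣tabulate∣≡sum (lookup S ∘ (σ ⟨$⟩ˡ_)) ⟩
  sum (indicator ∘ (σ ⟨$⟩ˡ_))  ≡⟨ sum-permute indicator (flip σ) ⟨
  sum indicator                ≡⟨ ∣tabulate∣≡sum (lookup S) ⟨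
  ∣ tabulate (lookup S) ∣      ≡⟨ cong ∣_∣ (tabulate∘lookup S) ⟩
  ∣ S ∣                        ∎
  where
  open ≡-Reasoning
  indicator : Fin _ → ℕ
  indicator i = if lookup S i then 1 else 0

imageK : Permutation′ n → KSubset n k → KSubset n k
imageK σ (S , p) = image σ S , trans (∣image∣ σ S) p

-- The input (x_{σ(S)})_S.
permute : ∀ n k → Permutation′ n → Input (n C k) → Input (n C k)
permute n k σ x =
  tabulate (λ i → lookup x (index {n} {k} (imageK σ (subsetAt i))))

IsHypergraphProperty : ∀ n k → BoolFun (n C k) → Set
IsHypergraphProperty n k f = ∀ x (σ : Permutation′ n) → f x ≡ f (permute n k σ x)

{-# OPTIONS --safe #-}

-- Let s = s(f) and suppose (k + 2) s < n; we show by induction on the number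
-- of edges that f takes the same value on every hypergraph as on the empty
-- one.  If this fails for Es but holds for all smaller hypergraphs, then
-- removing any edge of Es changes the value of f, so Es has at most s edges
-- and leaves a set J of at least n - k s > 2 s vertices isolated.
--
-- Filling: let J be a set of at least 2 s vertices that are interchangeable in
-- a hypergraph B, and let A be a (k-1)-set disjoint from J.  Then adding all
-- the edges A ∪ {w}, w ∈ J, preserves f.  Indeed, add them one at a time.  If
-- the value changes when |R| of them become |R| + 1, then by symmetry each of
-- the |J| - |R| missing edges is sensitive before the change, and each of the
-- |R| + 1 present edges is sensitive after it; both numbers are at most s, yet
-- they add up to |J| + 1.
--
-- Now let u be a vertex of some edge of Es, let L be the link of u, and let Ys
-- consist of the edges of Es that avoid u.  Filling Es at J, for every A in L,
-- gives the same hypergraph as filling Ys at J ∪ {u}.  Hence f takes the same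
-- value on Es and on the smaller hypergraph Ys.

module Submission where

open import Defs
open import Data.Bool.Base using (Bool; true; false; not; _xor_)
open import Data.Bool.Properties using (¬-not; xor-same; xor-assoc; xor-comm)
  renaming (_≟_ to _≟ᵇ_)
open import Data.Fin.Base using (Fin; zero; suc)
open import Data.Fin.Permutation
  using (Permutation′; _⟨$⟩ʳ_; _⟨$⟩ˡ_; inverseˡ; inverseʳ; transpose)
import Data.Fin.Permutation.Components as PC
open import Data.Fin.Properties using () renaming (_≟_ to _≟ᶠ_)
open import Data.Fin.Subset using (Subset; inside; outside; ∣_∣)
open import Data.Integer.Base using (+_; +≤+)
import Data.Integer.Base as ℤ
import Data.Integer.Properties as ℤ
open import Data.List.Base
  using (List; []; _∷_; _++_; allFin; concatMap; filter; length; map)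
open import Data.List.Extrema.Nat using (xs≤max)
open import Data.List.Membership.DecPropositional using (_∈?_)
open import Data.List.Membership.Propositional using (_∈_; _∉_)
open import Data.List.Membership.Propositional.Properties
  using (∈-∃++; ∈-++⁺ˡ; ∈-++⁺ʳ; ∈-++⁻; ∈-map⁺; ∈-map⁻; ∈-filter⁺; ∈-filter⁻; ∈-allFin;
         ∈-cartesianProductWith⁺; ∈-concatMap⁺)
open import Data.List.Membership.Propositional.Properties.WithK using (unique∧set⇒bag)
open import Data.List.Properties
  using (length-++; length-map; length-tabulate; map-++; map-∘; map-id-local; filter-notAll;
         partition-defn; ++-assoc)
open import Data.List.Relation.Binary.BagAndSetEquality using (∼bag⇒↭)
open import Data.List.Relation.Binary.Disjoint.Propositional using (Disjoint)
open import Data.List.Relation.Binary.Permutation.Propositional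
  using (_↭_; refl; prep; swap; ↭-refl; ↭-sym; ↭-trans; ↭-reflexive; ↭⇒↭ₛ; ↭ₛ⇒↭)
open import Data.List.Relation.Binary.Permutation.Propositional.Properties
  using (All-resp-↭; map⁺; ++⁺; ++⁺ˡ; shift; ↭-length)
import Data.List.Relation.Binary.Permutation.Setoid.Properties as ↭ₛ
open import Data.List.Relation.Binary.Subset.Propositional using (_⊆_)
open import Data.List.Relation.Binary.Subset.Propositional.Properties using (All-resp-⊇)
open import Data.List.Relation.Unary.All as All using (All; []; _∷_)
open import Data.List.Relation.Unary.All.Properties using (all-filter; filter⁺)
open import Data.List.Relation.Unary.AllPairs using ([]; _∷_)
open import Data.List.Relation.Unary.Any as Any using (here; there)
open import Data.List.Relation.Unary.Unique.Propositional using (Unique)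
import Data.List.Relation.Unary.Unique.Propositional.Properties as Unique
open import Data.Nat.Base using (ℕ; zero; suc; z≤n; s≤s; _≥_)
  renaming (_+_ to _+ℕ_; _*_ to _*ℕ_; _≤_ to _≤ℕ_; _<_ to _<ℕ_)
open import Data.Nat.Combinatorics using (_C_)
import Data.Nat.Properties as ℕ
open import Data.Product.Base using (∃; _×_; _,_; proj₁; proj₂)
open import Data.Rational.Base using (ℚ; 0ℚ; _<_; _≤_; _*_; _/_; toℚᵘ)
import Data.Rational.Properties as ℚ
open import Data.Rational.Unnormalised.Base using (mkℚᵘ; *≤*) renaming (_*_ to _*ᵘ_)
import Data.Rational.Unnormalised.Properties as ℚᵘ
open import Data.Sum.Base using ([_,_]′)
open import Data.Vec.Base using ([]; _∷_; lookup; tabulate; _[_]≔_)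
open import Data.Vec.Properties
  using (≡-dec; lookup∘tabulate; tabulate∘lookup; tabulate-cong; lookup∘update; lookup∘update′;
         lookup∘updateAt; lookup∘updateAt′; []≔-idempotent; []≔-lookup)
open import Function.Base using (_∘_; id)
open import Function.Bundles using (Inverse; mk⇔)
open import Relation.Binary.Definitions using (DecidableEquality)
open import Relation.Binary.PropositionalEquality
  using (_≡_; _≢_; refl; sym; trans; cong; cong₂; subst; subst₂; setoid; module ≡-Reasoning)
open import Relation.Nullary.Decidable
  using (yes; no; does; ¬?; dec-true; dec-false; decidable-stable)
open import Relation.Nullary.Negation.Core using (¬_; contradiction)
open import Relation.Unary using (Decidable)
open import Relation.Unary.Properties using (∁?)

private
  variable
    n m : ℕ
    A : Set

-- Lists without repetition and their rearrangements

remove-∈ : {x : A} {xs : List A} → x ∈ xs → ∃ λ ys → xs ↭ x ∷ ys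
remove-∈ x∈xs with ys , zs , refl ← ∈-∃++ x∈xs = ys ++ zs , shift _ ys zs

Unique-resp-↭ : {xs ys : List A} → xs ↭ ys → Unique xs → Unique ys
Unique-resp-↭ xs↭ys = ↭ₛ.Unique-resp-↭ (setoid _) (↭⇒↭ₛ xs↭ys)

unique-⊆⇒length≤ : {xs ys : List A} → Unique xs → xs ⊆ ys → length xs ≤ℕ length ys
unique-⊆⇒length≤ [] _ = z≤n
unique-⊆⇒length≤ {xs = x ∷ xs} (x∉xs ∷ xs!) xs⊆ys
  with as , bs , refl ← ∈-∃++ (xs⊆ys (here refl)) =
  subst (suc (length xs) ≤ℕ_) (sym (↭-length (shift x as bs)))
    (s≤s (unique-⊆⇒length≤ xs! λ y∈xs →
      [ ∈-++⁺ˡ , (λ { (here refl)  → contradiction refl (All.lookup x∉xs y∈xs)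
                    ; (there y∈bs) → ∈-++⁺ʳ as y∈bs }) ]′
      (∈-++⁻ as (xs⊆ys (there y∈xs)))))

filter-split-↭ : {P : A → Set} (P? : Decidable P) (xs : List A) →
                 xs ↭ filter P? xs ++ filter (∁? P?) xs
filter-split-↭ P? xs =
  subst (λ (ys , zs) → xs ↭ ys ++ zs) (partition-defn P? xs)
    (↭ₛ⇒↭ (↭ₛ.partition-↭ (setoid _) P? xs))

-- Transpositions of vertices

transpose-at : (v w : Fin n) → PC.transpose v w v ≡ w
transpose-at v w rewrite dec-true (v ≟ᶠ v) refl = refl

-- Stated for an arbitrary predicate so that it covers both membership in a list of vertices and
-- equality of bits of a subset.
transpose-preserves : (P : Fin n → Set) {v w : Fin n} → (P v → P w) → (P w → P v) →
                      ∀ {a} → P a → P (PC.transpose v w a)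
transpose-preserves P {v} {w} f g {a} pa with a ≟ᶠ v
... | yes refl = f pa
... | no _ with a ≟ᶠ w
...   | yes refl = g pa
...   | no _     = pa

-- The two implications say that `v` and `w` are both in `U` or both outside it. The two lists then
-- have the same members, and neither has repetitions.
map-transpose-↭ : {v w : Fin n} {U : List (Fin n)} → Unique U →
                  (v ∈ U → w ∈ U) → (w ∈ U → v ∈ U) →
                  map (transpose v w ⟨$⟩ʳ_) U ↭ U
map-transpose-↭ {v = v} {w} {U} U! v⇒w w⇒v =
  ∼bag⇒↭ (unique∧set⇒bag (Unique.map⁺ injective U!) U! (mk⇔ to from))
  where
  π = transpose v w
  injective : ∀ {a b} → π ⟨$⟩ʳ a ≡ π ⟨$⟩ʳ b → a ≡ b
  injective eq = trans (sym (inverseˡ π)) (trans (cong (π ⟨$⟩ˡ_) eq) (inverseˡ π))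
  to : ∀ {a} → a ∈ map (π ⟨$⟩ʳ_) U → a ∈ U
  to a∈ with b , b∈U , refl ← ∈-map⁻ _ a∈ = transpose-preserves (_∈ U) v⇒w w⇒v b∈U
  from : ∀ {a} → a ∈ U → a ∈ map (π ⟨$⟩ʳ_) U
  from a∈U = subst (_∈ map (π ⟨$⟩ʳ_) U) (inverseʳ π)
    (∈-map⁺ (π ⟨$⟩ʳ_) (transpose-preserves (_∈ U) w⇒v v⇒w a∈U))

-- Images of subsets, insertion and deletion of a vertex

_≟ˢ_ : DecidableEquality (Subset n)
_≟ˢ_ = ≡-dec _≟ᵇ_

image-injective : (σ : Permutation′ n) {S T : Subset n} → image σ S ≡ image σ T → S ≡ T
image-injective σ {S} {T} eq = begin
  S                    ≡⟨ tabulate∘lookup S ⟨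
  tabulate (lookup S)  ≡⟨ tabulate-cong (λ i → begin
    lookup S i                         ≡⟨ lookup-image σ S i ⟨
    lookup (image σ S) (σ ⟨$⟩ʳ i)      ≡⟨ cong (λ X → lookup X (σ ⟨$⟩ʳ i)) eq ⟩
    lookup (image σ T) (σ ⟨$⟩ʳ i)      ≡⟨ lookup-image σ T i ⟩
    lookup T i                         ∎) ⟩
  tabulate (lookup T)  ≡⟨ tabulate∘lookup T ⟩
  T                    ∎
  where open ≡-Reasoning

image-transpose-fix : {v w : Fin n} {S : Subset n} → lookup S v ≡ lookup S w →
                      image (transpose v w) S ≡ S
image-transpose-fix {v = v} {w} {S} eq =
  trans (tabulate-cong λ j →
          transpose-preserves (λ a → lookup S a ≡ lookup S j)
            (trans eq) (trans (sym eq)) {j} refl)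
        (tabulate∘lookup S)

image-insert : (σ : Permutation′ n) {S : Subset n} → image σ S ≡ S → ∀ a →
               image σ (S [ a ]≔ inside) ≡ S [ σ ⟨$⟩ʳ a ]≔ inside
image-insert σ {S} fix a = trans (tabulate-cong pointwise) (tabulate∘lookup _)
  where
  pointwise : ∀ j → lookup (S [ a ]≔ inside) (σ ⟨$⟩ˡ j) ≡ lookup (S [ σ ⟨$⟩ʳ a ]≔ inside) j
  pointwise j with j ≟ᶠ σ ⟨$⟩ʳ a
  ... | yes refl = trans (cong (lookup (S [ a ]≔ inside)) (inverseˡ σ))
                     (trans (lookup∘update a S inside) (sym (lookup∘update _ S inside)))
  ... | no j≢σa = begin
    lookup (S [ a ]≔ inside) (σ ⟨$⟩ˡ j)  ≡⟨ lookup∘update′ σ⁻¹j≢a S inside ⟩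
    lookup S (σ ⟨$⟩ˡ j)                  ≡⟨ lookup∘tabulate _ j ⟨
    lookup (image σ S) j                 ≡⟨ cong (λ X → lookup X j) fix ⟩
    lookup S j                           ≡⟨ lookup∘update′ j≢σa S inside ⟨
    lookup (S [ σ ⟨$⟩ʳ a ]≔ inside) j    ∎
    where
    open ≡-Reasoning
    σ⁻¹j≢a : σ ⟨$⟩ˡ j ≢ a
    σ⁻¹j≢a eq = j≢σa (trans (sym (inverseʳ σ)) (cong (σ ⟨$⟩ʳ_) eq))

∣insert∣ : (S : Subset n) (w : Fin n) → lookup S w ≡ outside → ∣ S [ w ]≔ inside ∣ ≡ suc ∣ S ∣
∣insert∣ (outside ∷ S) zero    _  = refl
∣insert∣ (inside  ∷ S) (suc w) eq = cong suc (∣insert∣ S w eq)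
∣insert∣ (outside ∷ S) (suc w) eq = ∣insert∣ S w eq

insert-injective : (S : Subset n) {v w : Fin n} → lookup S v ≡ outside →
                   S [ v ]≔ inside ≡ S [ w ]≔ inside → v ≡ w
insert-injective S {v} {w} v∉S eq with v ≟ᶠ w
... | yes v≡w = v≡w
... | no  v≢w = contradiction
  (trans (sym (lookup∘update v S inside))
    (trans (cong (λ X → lookup X v) eq) (trans (lookup∘update′ v≢w S inside) v∉S)))
  λ ()

delete-insert : (S : Subset n) (u : Fin n) → lookup S u ≡ inside →
                (S [ u ]≔ outside) [ u ]≔ inside ≡ S
delete-insert S u eq =
  trans ([]≔-idempotent S u) (trans (cong (S [ u ]≔_) (sym eq)) ([]≔-lookup S u))

-- Covered and isolated vertices

elements : Subset n → List (Fin n)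
elements []            = []
elements (inside  ∷ S) = zero ∷ map suc (elements S)
elements (outside ∷ S) = map suc (elements S)

length-elements : (S : Subset n) → length (elements S) ≡ ∣ S ∣
length-elements []            = refl
length-elements (inside  ∷ S) = cong suc (trans (length-map suc (elements S)) (length-elements S))
length-elements (outside ∷ S) = trans (length-map suc (elements S)) (length-elements S)

∈-elements : (S : Subset n) {w : Fin n} → lookup S w ≡ inside → w ∈ elements S
∈-elements (inside  ∷ S) {zero}  _  = here refl
∈-elements (inside  ∷ S) {suc w} eq = there (∈-map⁺ suc (∈-elements S eq))
∈-elements (outside ∷ S) {suc w} eq = ∈-map⁺ suc (∈-elements S eq)

nonempty : (S : Subset n) → ∣ S ∣ ≡ suc m → ∃ λ u → lookup S u ≡ inside
nonempty (inside  ∷ S) _  = zero , refl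
nonempty (outside ∷ S) eq with u , u∈S ← nonempty S eq = suc u , u∈S

-- A vertex is listed once for every edge through it. The length is then exact for uniform edges,
-- and it still bounds the number of non-isolated vertices from above.
covered : List (Subset n) → List (Fin n)
covered = concatMap elements

length-covered : {Es : List (Subset n)} → All (λ E → ∣ E ∣ ≡ m) Es →
                 length (covered Es) ≡ length Es *ℕ m
length-covered []                       = refl
length-covered {Es = E ∷ Es} (eq ∷ eqs) =
  trans (length-++ (elements E))
    (cong₂ _+ℕ_ (trans (length-elements E) eq) (length-covered eqs))

∈-covered : {Es : List (Subset n)} {E : Subset n} {w : Fin n} →
            E ∈ Es → lookup E w ≡ inside → w ∈ covered Es
∈-covered {E = E} E∈Es w∈E =
  ∈-concatMap⁺ elements (Any.map (λ { refl → ∈-elements E w∈E }) E∈Es)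

isolated : List (Subset n) → List (Fin n)
isolated {n} Es = filter (λ w → ¬? (_∈?_ _≟ᶠ_ w (covered Es))) (allFin n)

isolated-unique : (Es : List (Subset n)) → Unique (isolated Es)
isolated-unique {n} Es = Unique.filter⁺ _ (Unique.allFin⁺ n)

∈-isolated⁻ : (Es : List (Subset n)) {w : Fin n} → w ∈ isolated Es → w ∉ covered Es
∈-isolated⁻ Es w∈ = proj₂ (∈-filter⁻ _ {xs = allFin _} w∈)

isolated-avoids : {Es : List (Subset n)} {E : Subset n} {w : Fin n} →
                  E ∈ Es → w ∈ isolated Es → lookup E w ≡ outside
isolated-avoids {Es = Es} {E} {w} E∈Es w∈ with lookup E w in eq
... | inside  = contradiction (∈-covered E∈Es eq) (∈-isolated⁻ Es w∈)
... | outside = refl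

n≤isolated+covered : (Es : List (Subset n)) → n ≤ℕ length (isolated Es) +ℕ length (covered Es)
n≤isolated+covered {n} Es =
  subst₂ _≤ℕ_ (length-tabulate {n = n} id) (length-++ (isolated Es))
    (unique-⊆⇒length≤ (Unique.allFin⁺ n) λ {w} _ → split w)
  where
  split : ∀ w → w ∈ isolated Es ++ covered Es
  split w with _∈?_ _≟ᶠ_ w (covered Es)
  ... | yes w∈ = ∈-++⁺ʳ (isolated Es) w∈
  ... | no  w∉ = ∈-++⁺ˡ (∈-filter⁺ _ (∈-allFin w) w∉)

-- Hypergraphs as lists of edges modulo 2

-- A list of edges is read modulo 2: repeating an edge removes it.  Thus adding
-- an edge to the list flips the corresponding bit of the input.

parity : List (Subset n) → Subset n → Bool
parity []       S = false
parity (E ∷ Es) S = does (S ≟ˢ E) xor parity Es S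

xor-swap : ∀ a b c → a xor (b xor c) ≡ b xor (a xor c)
xor-swap a b c =
  trans (sym (xor-assoc a b c)) (trans (cong (_xor c) (xor-comm a b)) (xor-assoc b a c))

parity-↭ : {Es Es′ : List (Subset n)} → Es ↭ Es′ → ∀ S → parity Es S ≡ parity Es′ S
parity-↭ refl                            S = refl
parity-↭ (prep E p)                      S = cong (does (S ≟ˢ E) xor_) (parity-↭ p S)
parity-↭ (swap {xs = Es} E E′ p)         S =
  trans (xor-swap (does (S ≟ˢ E)) (does (S ≟ˢ E′)) (parity Es S))
    (cong (λ b → does (S ≟ˢ E′) xor (does (S ≟ˢ E) xor b)) (parity-↭ p S))
parity-↭ (_↭_.trans p q)                 S = trans (parity-↭ p S) (parity-↭ q S)

parity-cancel : (E : Subset n) (Es : List (Subset n)) → ∀ S → parity (E ∷ E ∷ Es) S ≡ parity Es S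
parity-cancel E Es S =
  trans (sym (xor-assoc (does (S ≟ˢ E)) (does (S ≟ˢ E)) (parity Es S)))
    (cong (_xor parity Es S) (xor-same (does (S ≟ˢ E))))

-- A permutation acts injectively on subsets, so every equality test in `parity` has the same
-- outcome before and after applying it.
parity-image : (σ : Permutation′ n) (Es : List (Subset n)) (S : Subset n) →
               parity (map (image σ) Es) (image σ S) ≡ parity Es S
parity-image σ []       S = refl
parity-image σ (E ∷ Es) S = cong₂ _xor_ same (parity-image σ Es S)
  where
  same : does (image σ S ≟ˢ image σ E) ≡ does (S ≟ˢ E)
  same with S ≟ˢ E
  ... | yes refl = dec-true (image σ S ≟ˢ image σ S) refl
  ... | no  S≢E  = dec-false (image σ S ≟ˢ image σ E) (S≢E ∘ image-injective σ)

parity-∉ : {Es : List (Subset n)} {S : Subset n} → S ∉ Es → parity Es S ≡ false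
parity-∉ {Es = []}         _ = refl
parity-∉ {Es = E ∷ Es} {S} S∉ rewrite dec-false (S ≟ˢ E) (S∉ ∘ here) = parity-∉ (S∉ ∘ there)

parity-∈ : {Es : List (Subset n)} {S : Subset n} → Unique Es → S ∈ Es → parity Es S ≡ true
parity-∈ {Es = E ∷ Es} (E∉ ∷ _) (here refl)
  rewrite dec-true (E ≟ˢ E) refl = cong not (parity-∉ λ E∈ → All.lookup E∉ E∈ refl)
parity-∈ {Es = E ∷ Es} {S} (E∉ ∷ Es!) (there S∈)
  rewrite dec-false (S ≟ˢ E) (λ { refl → All.lookup E∉ S∈ refl }) = parity-∈ Es! S∈

-- Sensitive bits

∈-allInputs : (x : Input m) → x ∈ allInputs m
∈-allInputs []      = here refl
∈-allInputs (b ∷ x) = ∈-cartesianProductWith⁺ _∷_ (∈-bits b) (∈-allInputs x)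
  where
  ∈-bits : ∀ b → b ∈ false ∷ true ∷ []
  ∈-bits false = here refl
  ∈-bits true  = there (here refl)

sensitivityAt≤sensitivity : (f : BoolFun m) (x : Input m) → sensitivityAt f x ≤ℕ sensitivity f
sensitivityAt≤sensitivity {m} f x =
  All.lookup (xs≤max 0 (map (sensitivityAt f) (allInputs m)))
    (∈-map⁺ (sensitivityAt f) (∈-allInputs x))

sensitive-bits : (f : BoolFun m) (x : Input m) {is : List (Fin m)} → Unique is →
                 (∀ {i} → i ∈ is → f x ≢ f (flipBit x i)) → length is ≤ℕ sensitivity f
sensitive-bits f x is! sensitive =
  ℕ.≤-trans
    (unique-⊆⇒length≤ is! λ i∈ → ∈-filter⁺ _ (∈-allFin _) (sensitive i∈))
    (sensitivityAt≤sensitivity f x)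

-- Stars and interchangeable vertices

star : Subset n → List (Fin n) → List (Subset n)
star A = map (A [_]≔ inside)

stars : List (Subset n) → List (Fin n) → List (Subset n)
stars L J = concatMap (λ A → star A J) L

-- Transpositions suffice, because two edges of a star are compared by a single swap. Reordering is
-- allowed because it does not affect `parity`.
Interchangeable : List (Fin n) → List (Subset n) → Set
Interchangeable J Es = ∀ {v w} → v ∈ J → w ∈ J → map (image (transpose v w)) Es ↭ Es

Avoids : List (Fin n) → Subset n → Set
Avoids J S = All (λ w → lookup S w ≡ outside) J

avoids⇒fix : {J : List (Fin n)} {S : Subset n} → Avoids J S →
             ∀ {v w} → v ∈ J → w ∈ J → image (transpose v w) S ≡ S
avoids⇒fix avoids v∈J w∈J =
  image-transpose-fix (trans (All.lookup avoids v∈J) (sym (All.lookup avoids w∈J)))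

avoids⇒interchangeable : {J : List (Fin n)} {Es : List (Subset n)} →
                         All (Avoids J) Es → Interchangeable J Es
avoids⇒interchangeable avoids v∈J w∈J =
  ↭-reflexive (map-id-local (All.map (λ a → avoids⇒fix a v∈J w∈J) avoids))

map-image-star : (σ : Permutation′ n) {A : Subset n} → image σ A ≡ A → ∀ U →
                 map (image σ) (star A U) ≡ star A (map (σ ⟨$⟩ʳ_) U)
map-image-star σ fix []      = refl
map-image-star σ fix (w ∷ U) = cong₂ _∷_ (image-insert σ fix w) (map-image-star σ fix U)

map-image-star-++ : {v w : Fin n} {A : Subset n} {U : List (Fin n)} {Es : List (Subset n)} →
  Unique U → (v ∈ U → w ∈ U) → (w ∈ U → v ∈ U) →
  image (transpose v w) A ≡ A → map (image (transpose v w)) Es ↭ Es →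
  map (image (transpose v w)) (star A U ++ Es) ↭ star A U ++ Es
map-image-star-++ {v = v} {w} {A} {U} {Es} U! v⇒w w⇒v fix Es-inv =
  ↭-trans (↭-reflexive (map-++ (image π) (star A U) Es))
    (++⁺ (↭-trans (↭-reflexive (map-image-star π fix U))
                  (map⁺ _ (map-transpose-↭ U! v⇒w w⇒v)))
         Es-inv)
  where π = transpose v w

-- A swap inside `J` fixes each centre `A` and permutes its star. Stars already added can therefore
-- count as background when another one is filled.
stars-interchangeable : {J : List (Fin n)} {L Es : List (Subset n)} → Unique J →
  All (Avoids J) L → Interchangeable J Es → Interchangeable J (stars L J ++ Es)
stars-interchangeable J! [] Es-inv = Es-inv
stars-interchangeable {J = J} {A ∷ L} {Es} J! (a ∷ as) Es-inv {v} {w} v∈J w∈J =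
  subst (λ X → map (image (transpose v w)) X ↭ X) (sym (++-assoc (star A J) (stars L J) Es))
    (map-image-star-++ J! (λ _ → w∈J) (λ _ → v∈J) (avoids⇒fix a v∈J w∈J)
      (stars-interchangeable J! as Es-inv v∈J w∈J))

-- When `L` is the link of `u`, the inserted sets on the right are exactly the edges through `u`.
-- This is why the two fillings in `detach` yield the same hypergraph.
stars-∷ : (L : List (Subset n)) (u : Fin n) (J : List (Fin n)) (Es : List (Subset n)) →
          stars L (u ∷ J) ++ Es ↭ stars L J ++ (map (_[ u ]≔ inside) L ++ Es)
stars-∷ []      u J Es = ↭-refl
stars-∷ (A ∷ L) u J Es = ↭-trans
  (prep E (↭-trans (↭-reflexive (++-assoc (star A J) (stars L (u ∷ J)) Es))
    (++⁺ˡ (star A J) (stars-∷ L u J Es))))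
  (↭-trans (↭-reflexive (cong (E ∷_) (sym (++-assoc (star A J) (stars L J) rest))))
    (↭-sym (shift E (star A J ++ stars L J) rest)))
  where
  E = A [ u ]≔ inside
  rest = map (_[ u ]≔ inside) L ++ Es

-- Values of the property on lists of edges

module _ {n j : ℕ} (f : BoolFun (n C suc j)) (symmetric : IsHypergraphProperty n (suc j) f) where

  private
    k = suc j
    s = sensitivity f

  variableOf : KSubset n k → Fin (n C k)
  variableOf = index

  edge : Fin (n C k) → Subset n
  edge i = proj₁ (subsetAt {n} {k} i)

  edge-variableOf : (E : KSubset n k) → edge (variableOf E) ≡ proj₁ E
  edge-variableOf E = cong proj₁ (Inverse.strictlyInverseʳ (index↔ n k) E)

  variableOf-edge : ∀ i → variableOf (subsetAt {n} {k} i) ≡ i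
  variableOf-edge = Inverse.strictlyInverseˡ (index↔ n k)

  edge-injective : ∀ {i i′} → edge i ≡ edge i′ → i ≡ i′
  edge-injective {i} {i′} eq =
    trans (sym (variableOf-edge i)) (trans (cong variableOf (KSubset-≡ eq)) (variableOf-edge i′))

  input : List (Subset n) → Input (n C k)
  input Es = tabulate (parity Es ∘ edge)

  value : List (Subset n) → Bool
  value Es = f (input Es)

  value-↭ : ∀ {Es Es′} → Es ↭ Es′ → value Es ≡ value Es′
  value-↭ p = cong f (tabulate-cong (parity-↭ p ∘ edge))

  value-cancel : ∀ E Es → value (E ∷ E ∷ Es) ≡ value Es
  value-cancel E Es = cong f (tabulate-cong (parity-cancel E Es ∘ edge))

  -- `permute` reads the bit of `S` at `σ(S)`, so permuting the input of the image list pulls it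
  -- back to the input of `Es`.
  value-image : ∀ σ Es → value (map (image σ) Es) ≡ value Es
  value-image σ Es = trans (symmetric x σ) (cong f (tabulate-cong λ i → begin
    lookup x (variableOf (imageK σ (subsetAt i)))
      ≡⟨ lookup∘tabulate (parity (map (image σ) Es) ∘ edge) (variableOf (imageK σ (subsetAt i))) ⟩
    parity (map (image σ) Es) (edge (variableOf (imageK σ (subsetAt i))))
      ≡⟨ cong (parity (map (image σ) Es)) (edge-variableOf (imageK σ (subsetAt i))) ⟩
    parity (map (image σ) Es) (image σ (edge i))
      ≡⟨ parity-image σ Es (edge i) ⟩
    parity Es (edge i) ∎))
    where
    open ≡-Reasoning
    x = input (map (image σ) Es)

  -- Modulo 2 this covers adding an absent edge and deleting a present one: at the bit of `E` the
  -- new summand is `true`, and at all others it is `false`.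
  input-∷ : ∀ E (∣E∣≡k : ∣ E ∣ ≡ k) Es →
            flipBit (input Es) (variableOf (E , ∣E∣≡k)) ≡ input (E ∷ Es)
  input-∷ E ∣E∣≡k Es = trans (sym (tabulate∘lookup _)) (tabulate-cong pointwise)
    where
    e = variableOf (E , ∣E∣≡k)
    pointwise : ∀ i → lookup (flipBit (input Es) e) i ≡ parity (E ∷ Es) (edge i)
    pointwise i with i ≟ᶠ e
    ... | yes refl rewrite dec-true (edge e ≟ˢ E) (edge-variableOf (E , ∣E∣≡k)) =
      trans (lookup∘updateAt e (input Es)) (cong not (lookup∘tabulate (parity Es ∘ edge) e))
    ... | no i≢e rewrite dec-false (edge i ≟ˢ E)
                   (λ eq → i≢e (edge-injective (trans eq (sym (edge-variableOf (E , ∣E∣≡k)))))) =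
      trans (lookup∘updateAt′ i e i≢e (input Es)) (lookup∘tabulate (parity Es ∘ edge) i)

  -- The link between sensitivity and edges. Since prepending toggles an edge, the bound serves for
  -- additions and for removals alike.
  sensitive-edges : ∀ Es {Ds} → Unique Ds → All (λ D → ∣ D ∣ ≡ k) Ds →
                    All (λ D → value (D ∷ Es) ≢ value Es) Ds → length Ds ≤ℕ s
  sensitive-edges Es {Ds} Ds! sizes sensitive =
    subst (_≤ℕ s) (length-indices sizes) (sensitive-bits f (input Es) (indices! Ds! sizes) λ i∈ →
      let D , D∈ , ∣D∣≡k , eq = ∈-indices⁻ sizes i∈
      in λ fx≡ → All.lookup sensitive D∈
           (sym (trans fx≡ (trans (cong (f ∘ flipBit (input Es)) eq)
                                  (cong f (input-∷ D ∣D∣≡k Es))))))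
    where
    indices : ∀ {Ds} → All (λ D → ∣ D ∣ ≡ k) Ds → List (Fin (n C k))
    indices = All.reduce λ {D} ∣D∣≡k → variableOf (D , ∣D∣≡k)

    length-indices : ∀ {Ds} (sizes : All (λ D → ∣ D ∣ ≡ k) Ds) → length (indices sizes) ≡ length Ds
    length-indices []       = refl
    length-indices (_ ∷ ps) = cong suc (length-indices ps)

    ∈-indices⁻ : ∀ {Ds} (sizes : All (λ D → ∣ D ∣ ≡ k) Ds) {i} → i ∈ indices sizes →
                 ∃ λ D → D ∈ Ds × ∃ λ (∣D∣≡k : ∣ D ∣ ≡ k) → i ≡ variableOf (D , ∣D∣≡k)
    ∈-indices⁻ (p ∷ ps) (here eq)  = _ , here refl , p , eq
    ∈-indices⁻ (p ∷ ps) (there i∈) with D , D∈ , rest ← ∈-indices⁻ ps i∈ = D , there D∈ , rest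

    indices! : ∀ {Ds} → Unique Ds → (sizes : All (λ D → ∣ D ∣ ≡ k) Ds) → Unique (indices sizes)
    indices! []         []       = []
    indices! {D ∷ _} (D∉ ∷ Ds!) (p ∷ ps) = All.tabulate fresh ∷ indices! Ds! ps
      where
      -- `edge` recovers an edge from its variable, so a repeated variable would mean a repeated
      -- edge.
      fresh : ∀ {i} → i ∈ indices ps → variableOf (D , p) ≢ i
      fresh i∈ eq with D′ , D′∈ , p′ , eq′ ← ∈-indices⁻ ps i∈ =
        All.lookup D∉ D′∈ (trans (sym (edge-variableOf (D , p)))
          (trans (cong edge (trans eq eq′)) (edge-variableOf (D′ , p′))))

  sensitive-star : ∀ Es {A U} → suc ∣ A ∣ ≡ k → Avoids U A → Unique U →
                   (∀ {w} → w ∈ U → value (A [ w ]≔ inside ∷ Es) ≢ value Es) → length U ≤ℕ s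
  sensitive-star Es {A} {U} ∣A∣ A-avoids U! sensitive =
    subst (_≤ℕ s) (length-map _ U)
      (sensitive-edges Es (star-unique A-avoids U!)
        (All.tabulate λ D∈ → let w , w∈ , eq = ∈-map⁻ _ D∈ in
          trans (cong ∣_∣ eq) (trans (∣insert∣ A w (All.lookup A-avoids w∈)) ∣A∣))
        (All.tabulate λ D∈ → let w , w∈ , eq = ∈-map⁻ _ D∈ in
          subst (λ D → value (D ∷ Es) ≢ value Es) (sym eq) (sensitive w∈)))
    where
    star-unique : ∀ {U} → Avoids U A → Unique U → Unique (star A U)
    star-unique []       []        = []
    star-unique (a ∷ as) (w∉ ∷ U!) =
      All.tabulate (λ D∈ eq → let v , v∈ , eq′ = ∈-map⁻ _ D∈ in
        All.lookup w∉ v∈ (insert-injective A a (trans eq eq′)))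
      ∷ star-unique as U!

  -- Swapping `w` and `v` carries one new edge to the other and keeps the remaining list up to
  -- order. Hence if toggling one of the two edges changes the value, so does toggling the other.
  twins : ∀ {A U Es v w} → Unique U → (w ∈ U → v ∈ U) → (v ∈ U → w ∈ U) →
          image (transpose w v) A ≡ A → map (image (transpose w v)) Es ↭ Es →
          value (A [ w ]≔ inside ∷ star A U ++ Es) ≡ value (A [ v ]≔ inside ∷ star A U ++ Es)
  twins {A} {U} {Es} {v} {w} U! w⇒v v⇒w fix Es-inv =
    trans (sym (value-image π (A [ w ]≔ inside ∷ star A U ++ Es)))
      (trans (cong (λ E → value (E ∷ map (image π) (star A U ++ Es)))
               (trans (image-insert π fix w) (cong (A [_]≔ inside) (transpose-at w v))))
             (value-↭ (prep _ (map-image-star-++ U! w⇒v v⇒w fix Es-inv))))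
    where π = transpose w v

  -- Filling a set of interchangeable vertices

  module _ {J : List (Fin n)} (2s≤∣J∣ : s +ℕ s ≤ℕ length J) where

    -- T and R are the parts of J whose edges are still missing and already present.
    fill-from : ∀ {A Es} → suc ∣ A ∣ ≡ k → Avoids J A → Interchangeable J Es →
                ∀ T R → Unique T → Unique R → Disjoint T R → T ⊆ J → R ⊆ J →
                length T +ℕ length R ≡ length J → value (star A R ++ Es) ≡ value Es
    fill-from ∣A∣ A-avoids Es-inv T [] _ _ _ _ _ _ = refl
    fill-from {A} {Es} ∣A∣ A-avoids Es-inv T (v ∷ R) T! (v∉R ∷ R!) T∩R T⊆J R⊆J len =
      trans (decidable-stable (_ ≟ᵇ _) λ changes →
              -- `len` says that `T` and `v ∷ R` together have the length of `J`. Since `v` is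
              -- counted both as missing before the change and as present after it, the two counts
              -- add up to one more than that.
              ℕ.<⇒≱ (s≤s (subst (s +ℕ s ≤ℕ_) (sym len) 2s≤∣J∣))
                (ℕ.+-mono-≤ (missing changes) (present changes)))
            (fill-from ∣A∣ A-avoids Es-inv (v ∷ T) R vT! R! vT∩R vT⊆J (R⊆J ∘ there)
              (trans (sym (ℕ.+-suc (length T) (length R))) len))
      where
      v∈J = R⊆J (here refl)

      vT⊆J : v ∷ T ⊆ J
      vT⊆J (here refl) = v∈J
      vT⊆J (there w∈T) = T⊆J w∈T

      vT! : Unique (v ∷ T)
      vT! = All.tabulate (λ { w∈T refl → T∩R (w∈T , here refl) }) ∷ T!

      vT∩R : Disjoint (v ∷ T) R
      vT∩R (here refl , w∈R) = All.lookup v∉R w∈R refl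
      vT∩R (there w∈T , w∈R) = T∩R (w∈T , there w∈R)

      Changes = value (star A (v ∷ R) ++ Es) ≢ value (star A R ++ Es)

      missing : Changes → length (v ∷ T) ≤ℕ s
      missing changes = sensitive-star (star A R ++ Es) ∣A∣ (All-resp-⊇ vT⊆J A-avoids) vT!
        λ w∈ eq → changes (trans (sym (twins R! (λ w∈R → contradiction (w∈ , w∈R) vT∩R)
                                      (λ v∈R → contradiction (here refl , v∈R) vT∩R)
                                      (avoids⇒fix A-avoids (vT⊆J w∈) v∈J)
                                      (Es-inv (vT⊆J w∈) v∈J)))
                       eq)

      -- Here prepending the edge at `w` deletes it. By `twins` this has the same effect as deleting
      -- the edge at `v`, which undoes the change.
      present : Changes → length (v ∷ R) ≤ℕ s
      present changes = sensitive-star (star A (v ∷ R) ++ Es) ∣A∣ (All-resp-⊇ R⊆J A-avoids) (v∉R ∷ R!)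
        λ w∈ eq → changes (trans (sym eq)
          (trans (twins (v∉R ∷ R!) (λ _ → here refl) (λ _ → w∈)
                   (avoids⇒fix A-avoids (R⊆J w∈) v∈J) (Es-inv (R⊆J w∈) v∈J))
                 (value-cancel (A [ v ]≔ inside) (star A R ++ Es))))

    -- The stars are peeled off one at a time, the later ones serving as background. Each peeling
    -- starts from a full star: nothing is missing and all of `J` is present.
    fill : ∀ {L Es} → Unique J → All (λ A → suc ∣ A ∣ ≡ k) L → All (Avoids J) L →
           Interchangeable J Es → value (stars L J ++ Es) ≡ value Es
    fill J! [] [] Es-inv = refl
    fill {A ∷ L} {Es} J! (∣A∣ ∷ sizes) (a ∷ as) Es-inv =
      trans (cong value (++-assoc (star A J) (stars L J) Es))
        (trans (fill-from ∣A∣ a (stars-interchangeable J! as Es-inv) [] J [] J!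
                 (λ ()) (λ ()) id refl)
               (fill J! sizes as Es-inv))

  -- Removing a vertex, and the induction on the number of edges

  module _ (small : (2 +ℕ k) *ℕ s <ℕ n) where

    Hypergraph : List (Subset n) → Set
    Hypergraph Es = Unique Es × All (λ E → ∣ E ∣ ≡ k) Es

    many-isolated : ∀ {Es} → Hypergraph Es → length Es ≤ℕ s → s +ℕ s ≤ℕ length (isolated Es)
    many-isolated {Es} (_ , sizes) ∣Es∣≤s = ℕ.+-cancelʳ-≤ (k *ℕ s) _ _ (begin
      (s +ℕ s) +ℕ k *ℕ s                               ≡⟨ ℕ.+-assoc s s (k *ℕ s) ⟩
      (2 +ℕ k) *ℕ s                                    ≤⟨ ℕ.<⇒≤ small ⟩
      n                                                ≤⟨ n≤isolated+covered Es ⟩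
      length (isolated Es) +ℕ length (covered Es)      ≡⟨ cong (length (isolated Es) +ℕ_)
                                                             (length-covered sizes) ⟩
      length (isolated Es) +ℕ length Es *ℕ k           ≤⟨ ℕ.+-monoʳ-≤ (length (isolated Es))
                                                             (ℕ.*-monoˡ-≤ k ∣Es∣≤s) ⟩
      length (isolated Es) +ℕ s *ℕ k                   ≡⟨ cong (length (isolated Es) +ℕ_)
                                                             (ℕ.*-comm s k) ⟩
      length (isolated Es) +ℕ k *ℕ s                   ∎)
      where open ℕ.≤-Reasoning

    detach : ∀ {Es} → Hypergraph Es → length Es ≤ℕ s → ∀ {E u} → E ∈ Es → lookup E u ≡ inside →
             value Es ≡ value (filter (∁? (λ D → lookup D u ≟ᵇ inside)) Es)
    detach {Es} hyp@(_ , sizes) ∣Es∣≤s {E} {u} E∈Es u∈E = begin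
      value Es
        ≡⟨ fill 2s≤∣J∣ J! L-sizes (All.map All.tail L-avoids) Es-inv ⟨
      value (stars L J ++ Es)
        -- Reinserting `u` into its link restores the edges through `u`; the other edges form `Ys`.
        ≡⟨ value-↭ (++⁺ˡ (stars L J) split) ⟩
      value (stars L J ++ (map (_[ u ]≔ inside) L ++ Ys))
        ≡⟨ value-↭ (stars-∷ L u J Ys) ⟨
      value (stars L (u ∷ J) ++ Ys)
        -- The vertex `u` lies on `E`, so it is not in `J`. No edge of `Ys` contains `u` or a vertex
        -- of `J`, so `u` is interchangeable with `J` there, though not necessarily in `Es`.
        ≡⟨ fill (ℕ.m≤n⇒m≤1+n 2s≤∣J∣) uJ! L-sizes L-avoids Ys-inv ⟩
      value Ys ∎
      where
      open ≡-Reasoning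
      P? = λ D → lookup D u ≟ᵇ inside
      Xs = filter P? Es
      Ys = filter (∁? P?) Es
      L  = map (_[ u ]≔ outside) Xs
      J  = isolated Es
      J! = isolated-unique Es
      2s≤∣J∣ = many-isolated hyp ∣Es∣≤s

      u∉J : ∀ {w} → w ∈ J → u ≢ w
      u∉J w∈J refl = ∈-isolated⁻ Es w∈J (∈-covered E∈Es u∈E)

      uJ! : Unique (u ∷ J)
      uJ! = All.tabulate u∉J ∷ J!

      split : Es ↭ map (_[ u ]≔ inside) L ++ Ys
      split = ↭-trans (filter-split-↭ P? Es) (↭-reflexive (cong (_++ Ys) (sym
        (trans (sym (map-∘ Xs))
               (map-id-local (All.map (delete-insert _ u) (all-filter P? Es)))))))

      Link : Subset n → Set
      Link A = ∃ λ D → D ∈ Es × lookup D u ≡ inside × A ≡ D [ u ]≔ outside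

      link⁻ : ∀ {A} → A ∈ L → Link A
      link⁻ A∈L with D , D∈Xs , eq ← ∈-map⁻ _ A∈L
                with D∈Es , u∈D ← ∈-filter⁻ P? D∈Xs = D , D∈Es , u∈D , eq

      L-sizes : All (λ A → suc ∣ A ∣ ≡ k) L
      L-sizes = All.tabulate λ A∈L → size (link⁻ A∈L)
        where
        size : ∀ {A} → Link A → suc ∣ A ∣ ≡ k
        size (D , D∈Es , u∈D , refl) =
          trans (sym (∣insert∣ (D [ u ]≔ outside) u (lookup∘update u D outside)))
            (trans (cong ∣_∣ (delete-insert D u u∈D)) (All.lookup sizes D∈Es))

      L-avoids : All (Avoids (u ∷ J)) L
      L-avoids = All.tabulate λ A∈L → avoids (link⁻ A∈L)
        where
        avoids : ∀ {A} → Link A → Avoids (u ∷ J) A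
        avoids (D , D∈Es , u∈D , refl) =
          lookup∘update u D outside ∷
          All.tabulate λ w∈J →
            trans (lookup∘update′ (u∉J w∈J ∘ sym) D outside) (isolated-avoids D∈Es w∈J)

      Es-inv : Interchangeable J Es
      Es-inv = avoids⇒interchangeable (All.tabulate λ D∈Es → All.tabulate (isolated-avoids D∈Es))

      Ys-inv : Interchangeable (u ∷ J) Ys
      Ys-inv = avoids⇒interchangeable (All.tabulate λ D∈Ys → avoids (∈-filter⁻ (∁? P?) D∈Ys))
        where
        avoids : ∀ {D} → D ∈ Es × ¬ lookup D u ≡ inside → Avoids (u ∷ J) D
        avoids (D∈Es , u∉D) = ¬-not u∉D ∷ All.tabulate (isolated-avoids D∈Es)

    -- The induction runs on a bound `ℓ` for the number of edges: `Es` without an arbitrary edge,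
    -- and `Es` without the edges at `u`, need not be tails of `Es`.
    value≡value[] : ∀ ℓ {Es} → length Es ≤ℕ ℓ → Hypergraph Es → value Es ≡ value []
    value≡value[] _       {[]}         _       _ = refl
    value≡value[] (suc ℓ) {Es@(E ∷ _)} ∣Es∣≤ℓ+1 hyp@(Es! , sizes@(∣E∣≡k ∷ _)) =
      decidable-stable (_ ≟ᵇ _) λ differs →
        let u , u∈E = nonempty E ∣E∣≡k
            P?      = λ D → lookup D u ≟ᵇ inside
            ∣Es∣≤s  = sensitive-edges Es Es! sizes (All.tabulate (removal differs))
        in differs (trans
             (detach hyp ∣Es∣≤s (here refl) u∈E)
             (value≡value[] ℓ
               -- The edge `E` contains `u` and is filtered out, so the list gets strictly shorter.
               (ℕ.≤-pred (ℕ.≤-trans (filter-notAll (∁? P?) Es (here λ u∉E → u∉E u∈E)) ∣Es∣≤ℓ+1))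
               (Unique.filter⁺ (∁? P?) Es! , filter⁺ (∁? P?) sizes)))
      where
      -- Modulo 2, `D ∷ Es` is `Es` without `D`, which has the value of the empty hypergraph by
      -- induction; `Es` itself was assumed not to.
      removal : value Es ≢ value [] → ∀ {D} → D ∈ Es → value (D ∷ Es) ≢ value Es
      removal differs {D} D∈Es eq with Ds , Es↭ ← remove-∈ D∈Es
                                  with _ ∷ Ds! ← Unique-resp-↭ Es↭ Es!
                                  with _ ∷ Ds-sizes ← All-resp-↭ Es↭ sizes =
        differs (begin
          value Es            ≡⟨ eq ⟨
          value (D ∷ Es)      ≡⟨ value-↭ (prep D Es↭) ⟩
          value (D ∷ D ∷ Ds)  ≡⟨ value-cancel D Ds ⟩
          value Ds            ≡⟨ value≡value[] ℓ
                                   (ℕ.≤-pred (subst (_≤ℕ suc ℓ) (↭-length Es↭) ∣Es∣≤ℓ+1))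
                                   (Ds! , Ds-sizes) ⟩
          value []            ∎)
        where open ≡-Reasoning

    -- Every input as a list of distinct edges

    edges : Input (n C k) → List (Subset n)
    edges x = map edge (filter (λ i → lookup x i ≟ᵇ true) (allFin (n C k)))

    edges-hypergraph : ∀ x → Hypergraph (edges x)
    edges-hypergraph x =
      Unique.map⁺ edge-injective (Unique.filter⁺ _ (Unique.allFin⁺ (n C k))) ,
      All.tabulate λ E∈ → let i , _ , eq = ∈-map⁻ edge E∈ in
        trans (cong ∣_∣ eq) (proj₂ (subsetAt {n} {k} i))

    input-edges : ∀ x → input (edges x) ≡ x
    input-edges x = trans (tabulate-cong bit) (tabulate∘lookup x)
      where
      bit : ∀ i → parity (edges x) (edge i) ≡ lookup x i
      bit i with lookup x i in eq
      ... | true  = parity-∈ (proj₁ (edges-hypergraph x))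
                             (∈-map⁺ edge (∈-filter⁺ _ (∈-allFin i) eq))
      ... | false = parity-∉ λ e∈ → absurd (∈-map⁻ edge e∈)
        where
        absurd : ¬ ∃ λ i′ →
          i′ ∈ filter (λ i → lookup x i ≟ᵇ true) (allFin (n C k)) × edge i ≡ edge i′
        absurd (i′ , i′∈ , e) with refl ← edge-injective e =
          contradiction (trans (sym eq) (proj₂ (∈-filter⁻ _ {xs = allFin _} i′∈))) λ ()

    constant : Constant f
    constant = value [] , λ x →
      trans (cong f (sym (input-edges x))) (value≡value[] _ ℕ.≤-refl (edges-hypergraph x))

  n≤[2+k]s : ¬ Constant f → n ≤ℕ (2 +ℕ k) *ℕ s
  n≤[2+k]s nonconstant = ℕ.≮⇒≥ (nonconstant ∘ constant)

-- The bound over the rationals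

1/m*n≤s : ∀ m n s → n ≤ℕ suc m *ℕ s → (+ 1 / suc m) * (+ n / 1) ≤ + s / 1
1/m*n≤s m n s n≤ = ℚ.toℚᵘ-cancel-≤ (begin
  toℚᵘ ((+ 1 / suc m) * (+ n / 1))          ≃⟨ ℚ.toℚᵘ-homo-* (+ 1 / suc m) (+ n / 1) ⟩
  toℚᵘ (+ 1 / suc m) *ᵘ toℚᵘ (+ n / 1)      ≃⟨ ℚᵘ.*-cong (ℚ.toℚᵘ-fromℚᵘ (mkℚᵘ (+ 1) m))
                                                          (ℚ.toℚᵘ-fromℚᵘ (mkℚᵘ (+ n) 0)) ⟩
  mkℚᵘ (+ 1) m *ᵘ mkℚᵘ (+ n) 0              ≤⟨ *≤* (subst₂ ℤ._≤_ lhs rhs (+≤+ n≤)) ⟩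
  mkℚᵘ (+ s) 0                              ≃⟨ ℚ.toℚᵘ-fromℚᵘ (mkℚᵘ (+ s) 0) ⟨
  toℚᵘ (+ s / 1)                            ∎)
  where
  open ℚᵘ.≤-Reasoning
  lhs : + n ≡ (+ 1 ℤ.* + n) ℤ.* + 1
  lhs = sym (trans (ℤ.*-identityʳ _) (ℤ.*-identityˡ (+ n)))
  rhs : + (suc m *ℕ s) ≡ + s ℤ.* + (suc m *ℕ 1)
  rhs = trans (cong +_ (trans (ℕ.*-comm (suc m) s)
                              (cong (s *ℕ_) (sym (ℕ.*-identityʳ (suc m))))))
              (ℤ.pos-* s (suc m *ℕ 1))

theorem6 : (k : ℕ) → k ≥ 1 →
    ∃ λ (c : ℚ) → 0ℚ < c ×
    ((n : ℕ) → n ≥ k → (f : BoolFun (n C k)) →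
    IsHypergraphProperty n k f → ¬ Constant f →
    c * (+ n / 1) ≤ + sensitivity f / 1)
-- With `k = suc j`, the denominator `3 +ℕ j` is `k + 2`, the factor in `n≤[2+k]s`.
theorem6 (suc j) _ =
  + 1 / (3 +ℕ j) ,
  ℚ.positive⁻¹ (+ 1 / (3 +ℕ j)) {{ℚ.normalize-pos 1 (3 +ℕ j)}} ,
  λ n _ f symmetric nonconstant →
    1/m*n≤s (2 +ℕ j) n (sensitivity f) (n≤[2+k]s f symmetric nonconstant)
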